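{- Let $n, m, k$ be positive integers, let $f : \mathbb{B}^n \to \mathbb{B}^m$ and $g : \mathbb{B}^m \to \mathbb{B}^k$ be Boolean functions, and let $\phi, \gamma \in G(\mathbb{B}^{n+m+k})$ be given by $\phi(x,y,z) = (x, y \oplus f(x), z)$ and $\gamma(x,y,z) = (x, y, z \oplus g(y))$ for $x \in \mathbb{B}^n$, $y \in \mathbb{B}^m$, $z \in \mathbb{B}^k$. Then the subgroup $$G_{2s} = \{e, \phi, \gamma, \phi \circ \gamma, (\phi \circ \gamma)^2, (\phi \circ \gamma)^3, \phi \circ (\gamma \circ \phi), \gamma \circ (\phi \circ \gamma)\}$$ of $G(\mathbb{B}^{n+m+k})$ generated by $\phi$ and $\gamma$ is isomorphic to the dihedral group $D_8$ of order $8$.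
   Context: $\mathbb{B} = \{0,1\}$, and $\oplus$ denotes (componentwise) Boolean exclusive-or. $G(\mathbb{B}^p)$ is the group, under functional composition, of invertible functions $\mathbb{B}^p \to \mathbb{B}^p$, and $e$ is its identity. Elements of $\mathbb{B}^{n+m+k}$ are written $(x,y,z)$ with $x\in\mathbb{B}^n$, $y\in\mathbb{B}^m$, $z\in\mathbb{B}^k$. The dihedral group $D_8$ is the 8-element group $\{e, A, A^2, A^3, B, AB, A^2B, A^3B\}$ with $A^4 = B^2 = (AB)^2 = e$.
   Formalization: The isomorphism with D_8 is proved under the added condition that g(y ⊕ f(x)) ≠ g(y) for some x, y; without it (e.g. f constantly 0, so φ = e) the group has order at most 4 and the claim fails. -}

module Defs where

open import Algebra.Bundles using (Group)
open import Algebra.Bundles.Raw using (RawGroup)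
open import Algebra.Morphism.Structures using (module GroupMorphisms)
import Algebra.Morphism.GroupMonomorphism as GroupMonomorphism
open import Data.Bool.Base using (Bool; _xor_)
open import Data.Bool.Properties using (xor-assoc; xor-same; xor-identityʳ)
open import Data.Fin.Base using (Fin; zero; suc; toℕ)
open import Data.Fin.Patterns using (0F; 1F)
open import Data.Fin.Properties using (_≟_; all?)
open import Data.List.Base using (List; []; _∷_)
import Data.List.Membership.Setoid as SetoidMembership
open import Data.Nat.Base using (ℕ; _+_; _∸_)
open import Data.Nat.DivMod using (_mod_)
open import Data.Product.Base using (Σ; _,_; _×_; ∃; proj₁; proj₂)
open import Data.Product.Properties using (≡-dec)
open import Data.Vec.Base using (Vec; []; _∷_; _++_; zipWith; take; drop)
open import Data.Vec.Properties using (take++drop≡id; ++-injective)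
open import Function.Base using (id)
open import Function.Bundles using (_↔_; mk↔ₛ′; module Inverse)
open import Function.Construct.Composition using (_↔-∘_)
open import Function.Construct.Identity using (↔-id)
open import Function.Construct.Symmetry using (↔-sym)
open import Level using (Level; _⊔_; 0ℓ)
open import Relation.Binary.Definitions using (DecidableEquality)
open import Relation.Binary.PropositionalEquality
  using (_≡_; _≢_; refl; sym; trans; cong; cong₂; isEquivalence; module ≡-Reasoning)
open import Relation.Nullary.Decidable using (from-yes)
open import Relation.Unary using (Pred)

private
  variable
    a b c ℓ p ℓ₁ ℓ₂ : Level
    n m k : ℕ

𝔹^ : ℕ → Set
𝔹^ p = Vec Bool p

infixl 6 _⊕_

_⊕_ : 𝔹^ n → 𝔹^ n → 𝔹^ n
_⊕_ = zipWith _xor_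

⊕-involutiveʳ : (u v : 𝔹^ n) → (u ⊕ v) ⊕ v ≡ u
⊕-involutiveʳ []       []       = refl
⊕-involutiveʳ (x ∷ xs) (y ∷ ys) = cong₂ _∷_ step (⊕-involutiveʳ xs ys)
  where
  step : (x xor y) xor y ≡ x
  step = trans (xor-assoc x y y) (trans (cong (x xor_) (xor-same y)) (xor-identityʳ x))

-- The product in G p is composition, (σ ∙ τ)(v) = σ (τ v), and two invertible
-- functions are identified when they agree pointwise: without function
-- extensionality, _≡_ on _↔_ would be too fine.
G : ℕ → Group 0ℓ 0ℓ
G p = record
  { Carrier = 𝔹^ p ↔ 𝔹^ p
  ; _≈_     = λ σ τ → ∀ v → to σ v ≡ to τ v
  ; _∙_     = _↔-∘_
  ; ε       = ↔-id (𝔹^ p)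
  ; _⁻¹     = ↔-sym
  ; isGroup = record
    { isMonoid = record
      { isSemigroup = record
        { isMagma = record
          { isEquivalence = record
            { refl  = λ _ → refl
            ; sym   = λ σ≈τ v → sym (σ≈τ v)
            ; trans = λ σ≈τ τ≈υ v → trans (σ≈τ v) (τ≈υ v)
            }
          ; ∙-cong = λ {σ} {σ′} {τ} {τ′} σ≈σ′ τ≈τ′ v →
              trans (cong (to σ) (τ≈τ′ v)) (σ≈σ′ (to τ′ v))
          }
        ; assoc = λ _ _ _ _ → refl
        }
      ; identity = (λ _ _ → refl) , (λ _ _ → refl)
      }
    ; inverse = (λ σ → strictlyInverseʳ σ) , (λ σ → strictlyInverseˡ σ)
    ; ⁻¹-cong = λ {σ} {τ} σ≈τ v →
        trans (cong (from σ) (sym (trans (σ≈τ (from τ v)) (strictlyInverseˡ τ v))))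
              (strictlyInverseʳ σ (from τ v))
    }
  }
  where open Inverse

infix 4 _∈ᴳ_

_∈ᴳ_ : 𝔹^ n ↔ 𝔹^ n → List (𝔹^ n ↔ 𝔹^ n) → Set
_∈ᴳ_ {n} = SetoidMembership._∈_ (Group.setoid (G n))

-- A vector of 𝔹^ (n + m + k) is written (x , y , z) = (x ++ y) ++ z.
module _ (n m k : ℕ) where

  xPart : 𝔹^ (n + m + k) → 𝔹^ n
  xPart v = take n (take (n + m) v)

  yPart : 𝔹^ (n + m + k) → 𝔹^ m
  yPart v = drop n (take (n + m) v)

  zPart : 𝔹^ (n + m + k) → 𝔹^ k
  zPart v = drop (n + m) v

  parts-η : ∀ v → (xPart v ++ yPart v) ++ zPart v ≡ v
  parts-η v = trans (cong (_++ zPart v) (take++drop≡id n (take (n + m) v)))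
                    (take++drop≡id (n + m) v)

  module _ (x : 𝔹^ n) (y : 𝔹^ m) (z : 𝔹^ k) where

    private
      v : 𝔹^ (n + m + k)
      v = (x ++ y) ++ z

      outer : take (n + m) v ≡ x ++ y × drop (n + m) v ≡ z
      outer = ++-injective (take (n + m) v) (x ++ y) (take++drop≡id (n + m) v)

      inner : xPart v ≡ x × yPart v ≡ y
      inner = ++-injective (xPart v) x
        (trans (take++drop≡id n (take (n + m) v)) (proj₁ outer))

    xPart-β : xPart ((x ++ y) ++ z) ≡ x
    xPart-β = proj₁ inner

    yPart-β : yPart ((x ++ y) ++ z) ≡ y
    yPart-β = proj₂ inner

    zPart-β : zPart ((x ++ y) ++ z) ≡ z
    zPart-β = proj₂ outer

module _ {n m : ℕ} (k : ℕ) (f : 𝔹^ n → 𝔹^ m) where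

  φ-fun : 𝔹^ (n + m + k) → 𝔹^ (n + m + k)
  φ-fun v = (x ++ (y ⊕ f x)) ++ z
    where
    x = xPart n m k v
    y = yPart n m k v
    z = zPart n m k v

  φ-fun-β : ∀ x y z → φ-fun ((x ++ y) ++ z) ≡ (x ++ (y ⊕ f x)) ++ z
  φ-fun-β x y z
    rewrite xPart-β n m k x y z | yPart-β n m k x y z | zPart-β n m k x y z = refl

  φ-fun-involutive : ∀ v → φ-fun (φ-fun v) ≡ v
  φ-fun-involutive v = begin
    φ-fun (φ-fun v)                     ≡⟨ φ-fun-β x (y ⊕ f x) z ⟩
    (x ++ ((y ⊕ f x) ⊕ f x)) ++ z       ≡⟨ cong (λ w → (x ++ w) ++ z) (⊕-involutiveʳ y (f x)) ⟩
    (x ++ y) ++ z                       ≡⟨ parts-η n m k v ⟩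
    v                                   ∎
    where
    open ≡-Reasoning
    x = xPart n m k v
    y = yPart n m k v
    z = zPart n m k v

  φ : Group.Carrier (G (n + m + k))
  φ = mk↔ₛ′ φ-fun φ-fun φ-fun-involutive φ-fun-involutive

module _ (n : ℕ) {m k : ℕ} (g : 𝔹^ m → 𝔹^ k) where

  γ-fun : 𝔹^ (n + m + k) → 𝔹^ (n + m + k)
  γ-fun v = (x ++ y) ++ (z ⊕ g y)
    where
    x = xPart n m k v
    y = yPart n m k v
    z = zPart n m k v

  γ-fun-β : ∀ x y z → γ-fun ((x ++ y) ++ z) ≡ (x ++ y) ++ (z ⊕ g y)
  γ-fun-β x y z
    rewrite xPart-β n m k x y z | yPart-β n m k x y z | zPart-β n m k x y z = refl

  γ-fun-involutive : ∀ v → γ-fun (γ-fun v) ≡ v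
  γ-fun-involutive v = begin
    γ-fun (γ-fun v)                     ≡⟨ γ-fun-β x y (z ⊕ g y) ⟩
    (x ++ y) ++ ((z ⊕ g y) ⊕ g y)       ≡⟨ cong ((x ++ y) ++_) (⊕-involutiveʳ z (g y)) ⟩
    (x ++ y) ++ z                       ≡⟨ parts-η n m k v ⟩
    v                                   ∎
    where
    open ≡-Reasoning
    x = xPart n m k v
    y = yPart n m k v
    z = zPart n m k v

  γ : Group.Carrier (G (n + m + k))
  γ = mk↔ₛ′ γ-fun γ-fun γ-fun-involutive γ-fun-involutive

-- Exactly the condition (φ ∘ γ)² ≠ e, without which the eight words listed in
-- G₂ₛ-elements are not distinct and the group they form has order at most 4
-- (for instance when f is constantly 0, so that φ = e).
NonDegenerate : (𝔹^ n → 𝔹^ m) → (𝔹^ m → 𝔹^ k) → Set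
NonDegenerate f g = ∃ λ x → ∃ λ y → g (y ⊕ f x) ≢ g y

module _ (𝒢 : Group c ℓ) where

  open Group 𝒢

  data Generated (S : Pred Carrier p) : Pred Carrier (c ⊔ ℓ ⊔ p) where
    gen  : ∀ {σ} → S σ → Generated S σ
    unit : Generated S ε
    mult : ∀ {σ τ} → Generated S σ → Generated S τ → Generated S (σ ∙ τ)
    inv  : ∀ {σ} → Generated S σ → Generated S (σ ⁻¹)
    resp : ∀ {σ τ} → σ ≈ τ → Generated S σ → Generated S τ

  module _ (S : Pred Carrier p) where

    private
      subRawGroup : RawGroup (c ⊔ ℓ ⊔ p) ℓ
      subRawGroup = record
        { Carrier = Σ Carrier (Generated S)
        ; _≈_     = λ (σ , _) (τ , _) → σ ≈ τ
        ; _∙_     = λ (σ , s) (τ , t) → σ ∙ τ , mult s t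
        ; ε       = ε , unit
        ; _⁻¹     = λ (σ , s) → σ ⁻¹ , inv s
        }

      inclusion : GroupMorphisms.IsGroupMonomorphism subRawGroup rawGroup proj₁
      inclusion = record
        { isGroupHomomorphism = record
          { isMonoidHomomorphism = record
            { isMagmaHomomorphism = record
              { isRelHomomorphism = record { cong = id }
              ; homo = λ _ _ → Group.refl 𝒢
              }
            ; ε-homo = Group.refl 𝒢
            }
          ; ⁻¹-homo = λ _ → Group.refl 𝒢
          }
        ; injective = id
        }

    generatedSubgroup : Group (c ⊔ ℓ ⊔ p) ℓ
    generatedSubgroup = record
      { RawGroup subRawGroup
      ; isGroup = GroupMonomorphism.isGroup inclusion isGroup
      }

infix 4 _≅_

_≅_ : Group a ℓ₁ → Group b ℓ₂ → Set (a ⊔ b ⊔ ℓ₁ ⊔ ℓ₂)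
𝒢 ≅ ℋ = ∃ (GroupMorphisms.IsGroupIsomorphism (Group.rawGroup 𝒢) (Group.rawGroup ℋ))

module _ {n m k : ℕ} (f : 𝔹^ n → 𝔹^ m) (g : 𝔹^ m → 𝔹^ k) where

  private
    module 𝒢 = Group (G (n + m + k))
    open 𝒢 using (_∙_)

    φ′ γ′ φγ : 𝒢.Carrier
    φ′ = φ k f
    γ′ = γ n g
    φγ = φ′ ∙ γ′

  generators : Pred 𝒢.Carrier 0ℓ
  generators = _∈ᴳ (φ′ ∷ γ′ ∷ [])

  G₂ₛ : Group 0ℓ 0ℓ
  G₂ₛ = generatedSubgroup (G (n + m + k)) generators

  G₂ₛ-elements : List 𝒢.Carrier
  G₂ₛ-elements =
      𝒢.ε
    ∷ φ′
    ∷ γ′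
    ∷ φγ
    ∷ φγ ∙ φγ
    ∷ φγ ∙ (φγ ∙ φγ)
    ∷ φ′ ∙ (γ′ ∙ φ′)
    ∷ γ′ ∙ (φ′ ∙ γ′)
    ∷ []

-- The pair (i , b) stands for Aⁱ Bᵇ; the product uses B Aʲ = A⁻ʲ B, which is
-- what (AB)² = e says given B² = e.
module Dihedral where

  Carrier : Set
  Carrier = Fin 4 × Fin 2

  infixl 7 _·_

  _·_ : Carrier → Carrier → Carrier
  (i , 0F) · (j , b) = (toℕ i + toℕ j) mod 4 , b
  (i , 1F) · (j , b) = (toℕ i + (4 ∸ toℕ j)) mod 4 , (1 + toℕ b) mod 2

  e A B : Carrier
  e = 0F , 0F
  A = 1F , 0F
  B = 0F , 1F

  infix 8 _⁻¹

  _⁻¹ : Carrier → Carrier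
  (i , 0F) ⁻¹ = (4 ∸ toℕ i) mod 4 , 0F
  (i , 1F) ⁻¹ = i , 1F

  infixr 8 _^_

  _^_ : Carrier → ℕ → Carrier
  s ^ ℕ.zero  = e
  s ^ ℕ.suc i = s · s ^ i

  A⁴≡e : A ^ 4 ≡ e
  A⁴≡e = refl

  B²≡e : B ^ 2 ≡ e
  B²≡e = refl

  [AB]²≡e : (A · B) ^ 2 ≡ e
  [AB]²≡e = refl

  private
    _≟D_ : DecidableEquality Carrier
    _≟D_ = ≡-dec _≟_ _≟_

  normalForm : ∀ i b → (i , b) ≡ A ^ toℕ i · B ^ toℕ b
  normalForm = from-yes (all? λ i → all? λ b → (i , b) ≟D (A ^ toℕ i · B ^ toℕ b))

  private
    assoc : ∀ i b j c k d → ((i , b) · (j , c)) · (k , d) ≡ (i , b) · ((j , c) · (k , d))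
    assoc = from-yes
      (all? λ i → all? λ b → all? λ j → all? λ c → all? λ k → all? λ d →
        (((i , b) · (j , c)) · (k , d)) ≟D ((i , b) · ((j , c) · (k , d))))

    identityˡ : ∀ i b → e · (i , b) ≡ (i , b)
    identityˡ = from-yes (all? λ i → all? λ b → (e · (i , b)) ≟D (i , b))

    identityʳ : ∀ i b → (i , b) · e ≡ (i , b)
    identityʳ = from-yes (all? λ i → all? λ b → ((i , b) · e) ≟D (i , b))

    inverseˡ : ∀ i b → (i , b) ⁻¹ · (i , b) ≡ e
    inverseˡ = from-yes (all? λ i → all? λ b → ((i , b) ⁻¹ · (i , b)) ≟D e)

    inverseʳ : ∀ i b → (i , b) · (i , b) ⁻¹ ≡ e
    inverseʳ = from-yes (all? λ i → all? λ b → ((i , b) · (i , b) ⁻¹) ≟D e)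

  group : Group 0ℓ 0ℓ
  group = record
    { Carrier = Carrier
    ; _≈_     = _≡_
    ; _∙_     = _·_
    ; ε       = e
    ; _⁻¹     = _⁻¹
    ; isGroup = record
      { isMonoid = record
        { isSemigroup = record
          { isMagma = record { isEquivalence = isEquivalence ; ∙-cong = cong₂ _·_ }
          ; assoc   = λ (i , b) (j , c) (k , d) → assoc i b j c k d
          }
        ; identity = (λ (i , b) → identityˡ i b) , (λ (i , b) → identityʳ i b)
        }
      ; inverse = (λ (i , b) → inverseˡ i b) , (λ (i , b) → inverseʳ i b)
      ; ⁻¹-cong = cong _⁻¹
      }
    }

D₈ : Group 0ℓ 0ℓ
D₈ = Dihedral.group

{-# OPTIONS --safe #-}
-- In any group, involutions s and t with (st)⁴ = ε give a homomorphism D₈ → 𝒢 sending A to st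
-- and B to t, whose image is the subgroup generated by s and t. Every nontrivial normal
-- subgroup of D₈ contains the central element A², so the homomorphism is injective as soon as
-- (st)² ≠ ε. Here (φγ)²(x , y , z) = (x , y , z ⊕ g(y) ⊕ g(y ⊕ f(x))), which is an involution,
-- and it differs from the identity precisely in the nondegenerate case.
module Submission where

open import Defs
open import Algebra.Bundles using (Group)
import Algebra.Properties.Group as GroupProperties
import Algebra.Properties.Monoid.Mult as MonoidMult
open import Data.Bool.Base using (false)
open import Data.Bool.Properties using (xor-assoc; xor-comm)
open import Data.Fin.Base using (Fin; toℕ)
open import Data.Fin.Patterns using (0F; 1F; 2F)
open import Data.Fin.Properties using (_≟_; all?; any?; toℕ<n; toℕ-fromℕ<)
open import Data.List.Base using (List; []; _∷_; map)
import Data.List.Membership.DecPropositional as DecMembership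
import Data.List.Membership.Setoid as SetoidMembership
import Data.List.Membership.Setoid.Properties as SetoidMembershipₚ
open import Data.List.Relation.Binary.Pointwise using (Pointwise; []; _∷_)
import Data.List.Relation.Binary.Equality.Setoid as SetoidEquality
open import Data.List.Relation.Unary.Any using (here; there)
open import Data.Nat.Base using (ℕ; zero; suc; _+_; _*_; _∸_; NonZero)
open import Data.Nat.DivMod using (_mod_; _/_; m≡m%n+[m/n]*n; m%n<n)
open import Data.Nat.Properties using (m∸n+n≡m; <⇒≤) renaming (+-comm to ℕ-+-comm)
open import Data.Product.Base using (∃; _,_; _×_; proj₁; proj₂)
open import Data.Product.Properties using (≡-dec)
open import Data.Sum.Base using (_⊎_; inj₁; inj₂)
open import Data.Vec.Base using (replicate; _++_)
open import Data.Vec.Properties using (zipWith-assoc; zipWith-comm; ++-injectiveʳ)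
open import Function.Bundles using (_⇔_; mk⇔; module Inverse)
open import Relation.Binary.Definitions using (DecidableEquality)
open import Relation.Binary.PropositionalEquality as ≡ using (_≡_)
import Relation.Binary.Reasoning.Setoid as SetoidReasoning
open import Relation.Nullary.Decidable using (from-yes; _⊎-dec_)
open import Relation.Nullary.Negation.Core using (¬_; contradiction)
open import Relation.Unary using (Pred)

open Dihedral using (e; A; B; _·_) renaming (Carrier to D; _⁻¹ to infix 8 _⁻¹ᴰ)

-- Facts about `D₈` settled by finite enumeration.

_≟ᴰ_ : DecidableEquality D
_≟ᴰ_ = ≡-dec _≟_ _≟_

A² : D
A² = 2F , 0F

-- The centre of `D₈` is `e` and `A²`, and its commutator subgroup is the same, so each noncentral
-- `d` has a commutator equal to `A²`. This is the elementwise form of the claim about nontrivial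
-- normal subgroups.
e-or-A²-or-commutator : ∀ i b → let d = (i , b) in
  d ≡ e ⊎ d ≡ A² ⊎ ∃ λ j → ∃ λ c → let x = (j , c) in d · (x · (d ⁻¹ᴰ · x ⁻¹ᴰ)) ≡ A²
e-or-A²-or-commutator = from-yes (all? λ i → all? λ b →
  let d = (i , b) in
  (d ≟ᴰ e) ⊎-dec (d ≟ᴰ A²) ⊎-dec
  any? λ j → any? λ c → let x = (j , c) in (d · (x · (d ⁻¹ᴰ · x ⁻¹ᴰ))) ≟ᴰ A²)

-- The words of G₂ₛ-elements, with φ read as AB and γ as B.
words : List D
words = e ∷ s ∷ t ∷ s · t ∷ (s · t) · (s · t) ∷ (s · t) · ((s · t) · (s · t))
      ∷ s · (t · s) ∷ t · (s · t) ∷ []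
  where
  s t : D
  s = A · B
  t = B

words-complete : ∀ i b → let open DecMembership _≟ᴰ_ in (i , b) ∈ words
words-complete = from-yes (all? λ i → all? λ b → (i , b) ∈? words)
  where open DecMembership _≟ᴰ_

-- Periodic powers and cancellation of involutions in a group.

module _ {c ℓ} (𝒢 : Group c ℓ) where

  open Group 𝒢
  open GroupProperties 𝒢
  open MonoidMult monoid renaming (_×_ to power)
  open SetoidReasoning setoid

  power-periodic : ∀ {x} n q → power n x ≈ ε → power (q * n) x ≈ ε
  power-periodic         n zero    xⁿ≈ε = refl
  power-periodic {x = x} n (suc q) xⁿ≈ε = begin
    power (n + q * n) x          ≈⟨ ×-homo-+ x n (q * n) ⟩
    power n x ∙ power (q * n) x  ≈⟨ ∙-cong xⁿ≈ε (power-periodic n q xⁿ≈ε) ⟩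
    ε ∙ ε                        ≈⟨ identityˡ ε ⟩
    ε                            ∎

  -- Lets the reductions `mod 4` and `mod 2` in the product of `D` be undone once powers are taken.
  power-mod : ∀ {x} n .{{_ : NonZero n}} a → power n x ≈ ε →
              power (toℕ (a mod n)) x ≈ power a x
  power-mod {x} n a xⁿ≈ε = begin
    power r x                      ≈⟨ identityʳ _ ⟨
    power r x ∙ ε                  ≈⟨ ∙-congˡ (power-periodic n (a / n) xⁿ≈ε) ⟨
    power r x ∙ power (a / n * n) x ≈⟨ ×-homo-+ x r (a / n * n) ⟨
    power (r + a / n * n) x        ≡⟨ ≡.cong (λ i → power (i + a / n * n) x) (toℕ-fromℕ< (m%n<n a n)) ⟩
    _                              ≡⟨ ≡.cong (λ i → power i x) (m≡m%n+[m/n]*n a n) ⟨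
    power a x                      ∎
    where r = toℕ (a mod n)

  cancelˡ : ∀ {x} → x ∙ x ≈ ε → ∀ y → x ∙ (x ∙ y) ≈ y
  cancelˡ {x} x²≈ε y = begin
    x ∙ (x ∙ y)  ≈⟨ assoc x x y ⟨
    (x ∙ x) ∙ y  ≈⟨ ∙-congʳ x²≈ε ⟩
    ε ∙ y        ≈⟨ identityˡ y ⟩
    y            ∎

  cancelʳ : ∀ {x} → x ∙ x ≈ ε → ∀ y → (y ∙ x) ∙ x ≈ y
  cancelʳ {x} x²≈ε y = begin
    (y ∙ x) ∙ x  ≈⟨ assoc y x x ⟩
    y ∙ (x ∙ x)  ≈⟨ ∙-congˡ x²≈ε ⟩
    y ∙ ε        ≈⟨ identityʳ y ⟩
    y            ∎

  Generated-power : ∀ {p} {S : Pred Carrier p} n {x} →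
                    Generated 𝒢 S x → Generated 𝒢 S (power n x)
  Generated-power zero    x∈S = unit
  Generated-power (suc n) x∈S = mult x∈S (Generated-power n x∈S)

  -- The homomorphism from `D₈` given by two involutions.

  module DihedralImage (s t : Carrier) (s²≈ε : s ∙ s ≈ ε) (t²≈ε : t ∙ t ≈ ε)
                       (r⁴≈ε : power 4 (s ∙ t) ≈ ε) where

    open SetoidMembership setoid using (_∈_)

    r : Carrier
    r = s ∙ t

    h : D → Carrier
    h (i , b) = power (toℕ i) r ∙ power (toℕ b) t

    -- The inversion of `r` under conjugation by `t`, stated without inverses. The induction
    -- collapses the inner copy to `t`, leaving `r t r = s t t s t = t`.
    rⁱtrⁱ≈t : ∀ i → power i r ∙ (t ∙ power i r) ≈ t
    rⁱtrⁱ≈t zero    = trans (identityˡ _) (identityʳ t)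
    rⁱtrⁱ≈t (suc i) = begin
      power (suc i) r ∙ (t ∙ power (suc i) r)        ≈⟨ ∙-congˡ (∙-congˡ power-suc) ⟩
      (r ∙ power i r) ∙ (t ∙ (power i r ∙ r))        ≈⟨ assoc r _ _ ⟩
      r ∙ (power i r ∙ (t ∙ (power i r ∙ r)))        ≈⟨ ∙-congˡ (∙-congˡ (assoc t _ _)) ⟨
      r ∙ (power i r ∙ ((t ∙ power i r) ∙ r))        ≈⟨ ∙-congˡ (assoc _ _ _) ⟨
      r ∙ ((power i r ∙ (t ∙ power i r)) ∙ r)        ≈⟨ ∙-congˡ (∙-congʳ (rⁱtrⁱ≈t i)) ⟩
      r ∙ (t ∙ r)                                    ≈⟨ assoc r t r ⟨
      (r ∙ t) ∙ r                                    ≈⟨ ∙-congʳ (cancelʳ t²≈ε s) ⟩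
      s ∙ (s ∙ t)                                    ≈⟨ cancelˡ s²≈ε t ⟩
      t                                              ∎
      where
      power-suc : power (suc i) r ≈ power i r ∙ r
      power-suc = begin
        power (1 + i) r         ≡⟨ ≡.cong (λ j → power j r) (ℕ-+-comm 1 i) ⟩
        power (i + 1) r         ≈⟨ ×-homo-+ r i 1 ⟩
        power i r ∙ power 1 r   ≈⟨ ∙-congˡ (×-homo-1 r) ⟩
        power i r ∙ r           ∎

    -- Writing `t` as `rʲ t rʲ` makes the exponents on the left add up to 4. This is the rule by
    -- which the product of `D` moves `B` past a power of `A`.
    r⁴⁻ʲt≈trʲ : ∀ (j : Fin 4) → power (4 ∸ toℕ j) r ∙ t ≈ t ∙ power (toℕ j) r
    r⁴⁻ʲt≈trʲ j = begin
      power (4 ∸ toℕ j) r ∙ t                               ≈⟨ ∙-congˡ (rⁱtrⁱ≈t (toℕ j)) ⟨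
      power (4 ∸ toℕ j) r ∙ (rʲ ∙ (t ∙ rʲ))                 ≈⟨ assoc _ _ _ ⟨
      (power (4 ∸ toℕ j) r ∙ rʲ) ∙ (t ∙ rʲ)                 ≈⟨ ∙-congʳ (×-homo-+ r (4 ∸ toℕ j) (toℕ j)) ⟨
      power (4 ∸ toℕ j + toℕ j) r ∙ (t ∙ rʲ)                ≡⟨ ≡.cong (λ i → power i r ∙ (t ∙ rʲ)) (m∸n+n≡m (<⇒≤ (toℕ<n j))) ⟩
      power 4 r ∙ (t ∙ rʲ)                                  ≈⟨ ∙-congʳ r⁴≈ε ⟩
      ε ∙ (t ∙ rʲ)                                          ≈⟨ identityˡ _ ⟩
      t ∙ rʲ                                                ∎
      where rʲ = power (toℕ j) r

    h-homo : ∀ d d′ → h (d · d′) ≈ h d ∙ h d′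
    h-homo (i , 0F) (j , b) = begin
      power (toℕ ((toℕ i + toℕ j) mod 4)) r ∙ tᵇ  ≈⟨ ∙-congʳ (power-mod 4 (toℕ i + toℕ j) r⁴≈ε) ⟩
      power (toℕ i + toℕ j) r ∙ tᵇ                ≈⟨ ∙-congʳ (×-homo-+ r (toℕ i) (toℕ j)) ⟩
      (rⁱ ∙ rʲ) ∙ tᵇ                              ≈⟨ assoc _ _ _ ⟩
      -- The inserted `ε` is `power 0 t`, the reflection part of `h (i , 0F)`.
      rⁱ ∙ (rʲ ∙ tᵇ)                              ≈⟨ ∙-congʳ (identityʳ rⁱ) ⟨
      (rⁱ ∙ ε) ∙ (rʲ ∙ tᵇ)                        ∎
      where
      rⁱ = power (toℕ i) r
      rʲ = power (toℕ j) r
      tᵇ = power (toℕ b) t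
    h-homo (i , 1F) (j , b) = begin
      power (toℕ ((toℕ i + (4 ∸ toℕ j)) mod 4)) r ∙ power (toℕ ((1 + toℕ b) mod 2)) t
        ≈⟨ ∙-cong (power-mod 4 (toℕ i + (4 ∸ toℕ j)) r⁴≈ε)
                  (power-mod 2 (1 + toℕ b) (trans (∙-congˡ (identityʳ t)) t²≈ε)) ⟩
      power (toℕ i + (4 ∸ toℕ j)) r ∙ (t ∙ tᵇ)       ≈⟨ ∙-congʳ (×-homo-+ r (toℕ i) (4 ∸ toℕ j)) ⟩
      (rⁱ ∙ r⁻ʲ) ∙ (t ∙ tᵇ)                          ≈⟨ assoc _ _ _ ⟩
      rⁱ ∙ (r⁻ʲ ∙ (t ∙ tᵇ))                          ≈⟨ ∙-congˡ (assoc _ _ _) ⟨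
      rⁱ ∙ ((r⁻ʲ ∙ t) ∙ tᵇ)                          ≈⟨ ∙-congˡ (∙-congʳ (r⁴⁻ʲt≈trʲ j)) ⟩
      rⁱ ∙ ((t ∙ rʲ) ∙ tᵇ)                           ≈⟨ ∙-congˡ (assoc _ _ _) ⟩
      rⁱ ∙ (t ∙ (rʲ ∙ tᵇ))                           ≈⟨ assoc _ _ _ ⟨
      (rⁱ ∙ t) ∙ (rʲ ∙ tᵇ)                           ≈⟨ ∙-congʳ (∙-congˡ (identityʳ t)) ⟨
      (rⁱ ∙ (t ∙ ε)) ∙ (rʲ ∙ tᵇ)                     ∎
      where
      rⁱ = power (toℕ i) r
      rʲ = power (toℕ j) r
      r⁻ʲ = power (4 ∸ toℕ j) r
      tᵇ = power (toℕ b) t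

    h-e : h e ≈ ε
    h-e = identityˡ ε

    h-⁻¹ : ∀ d → h (d ⁻¹ᴰ) ≈ h d ⁻¹
    h-⁻¹ d = inverseˡ-unique _ _ (begin
      h (d ⁻¹ᴰ) ∙ h d  ≈⟨ h-homo (d ⁻¹ᴰ) d ⟨
      h (d ⁻¹ᴰ · d)    ≡⟨ ≡.cong h (Group.inverseˡ D₈ d) ⟩
      h e              ≈⟨ h-e ⟩
      ε                ∎)

    h-B : h B ≈ t
    h-B = trans (identityˡ _) (identityʳ t)

    h-AB : h (A · B) ≈ s
    h-AB = begin
      (r ∙ ε) ∙ (t ∙ ε)  ≈⟨ ∙-cong (identityʳ r) (identityʳ t) ⟩
      (s ∙ t) ∙ t        ≈⟨ cancelʳ t²≈ε s ⟩
      s                  ∎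

    -- The image of `h` as a list of eight words and as the generated subgroup.

    elements : List Carrier
    elements = ε ∷ s ∷ t ∷ r ∷ r ∙ r ∷ r ∙ (r ∙ r) ∷ s ∙ (t ∙ s) ∷ t ∙ (s ∙ t) ∷ []

    h-words : Pointwise _≈_ (map h words) elements
    h-words =
        h-e ∷ h-AB ∷ h-B ∷ h-A ∷ h-AA ∷ h-· A A² h-A h-AA
      ∷ h-· (A · B) (B · (A · B)) h-AB (h-· B (A · B) h-B h-AB)
      ∷ h-· B ((A · B) · B) h-B h-A
      ∷ []
      where
      h-· : ∀ d d′ {x y} → h d ≈ x → h d′ ≈ y → h (d · d′) ≈ x ∙ y
      h-· d d′ hd≈x hd′≈y = trans (h-homo d d′) (∙-cong hd≈x hd′≈y)
      h-A : h A ≈ r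
      -- `(A · B) · B` computes to `A`, just as `A · A` computes to `A²` below.
      h-A = h-· (A · B) B h-AB h-B
      h-AA : h A² ≈ r ∙ r
      h-AA = h-· A A h-A h-A

    ⟨s,t⟩ : Pred Carrier _
    ⟨s,t⟩ = Generated 𝒢 (_∈ (s ∷ t ∷ []))

    -- The image of `h` contains `s` and `t` and is closed under the group operations, so induction
    -- on the derivation applies.
    Generated⇒image : ∀ {σ} → ⟨s,t⟩ σ → ∃ λ d → h d ≈ σ
    Generated⇒image (gen (here σ≈s))         = A · B , trans h-AB (sym σ≈s)
    Generated⇒image (gen (there (here σ≈t))) = B , trans h-B (sym σ≈t)
    Generated⇒image unit                     = e , h-e
    Generated⇒image (mult p q)               =
      let d , hd≈σ = Generated⇒image p ; d′ , hd′≈τ = Generated⇒image q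
      in  d · d′ , trans (h-homo d d′) (∙-cong hd≈σ hd′≈τ)
    Generated⇒image (inv p)                  =
      let d , hd≈σ = Generated⇒image p
      in  d ⁻¹ᴰ , trans (h-⁻¹ d) (⁻¹-cong hd≈σ)
    Generated⇒image (resp σ≈τ p)             =
      let d , hd≈σ = Generated⇒image p
      in  d , trans hd≈σ σ≈τ

    image⇒Generated : ∀ d → ⟨s,t⟩ (h d)
    image⇒Generated (i , b) =
      mult (Generated-power (toℕ i) (mult (gen (here refl)) ⟨t⟩)) (Generated-power (toℕ b) ⟨t⟩)
      where
      ⟨t⟩ : ⟨s,t⟩ t
      ⟨t⟩ = gen (there (here refl))

    -- The list is a parameter, fixed only up to pointwise `_≈_`, so that it need not be
    -- definitionally equal to `elements`.
    Generated⇔members : ∀ {xs} → Pointwise _≈_ elements xs → ∀ σ → ⟨s,t⟩ σ ⇔ σ ∈ xs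
    Generated⇔members {xs} elements≋xs σ = mk⇔ to from
      where
      open SetoidMembershipₚ
      open SetoidEquality setoid using (_≋_; ≋-sym; ≋-trans)
      h-words≋xs : map h words ≋ xs
      h-words≋xs = ≋-trans h-words elements≋xs
      to : ⟨s,t⟩ σ → σ ∈ xs
      to p =
        let (i , b) , hd≈σ = Generated⇒image p
        in  ∈-resp-≈ setoid hd≈σ (∈-resp-≋ setoid h-words≋xs
              (∈-map⁺ (≡.setoid D) setoid {f = h} (λ d≡d′ → reflexive (≡.cong h d≡d′))
                (words-complete i b)))
      from : σ ∈ xs → ⟨s,t⟩ σ
      from σ∈ =
        let d , _ , σ≈hd = ∈-map⁻ (≡.setoid D) setoid {xs = words} {f = h}
                             (∈-resp-≋ setoid (≋-sym h-words≋xs) σ∈)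
        in  resp (sym σ≈hd) (image⇒Generated d)

    -- Injectivity of `h` and the isomorphism.

    module _ (r²≉ε : ¬ power 2 r ≈ ε) where

      hA²≉ε : ¬ h A² ≈ ε
      hA²≉ε hA²≈ε = r²≉ε (trans (sym (identityʳ _)) hA²≈ε)

      -- A kernel element has all its commutators in the kernel, so a noncentral one would put `A²`
      -- there; `A²` itself is excluded by `hA²≉ε`.
      h-kernel : ∀ d → h d ≈ ε → d ≡ e
      h-kernel d@(i , b) hd≈ε with e-or-A²-or-commutator i b
      ... | inj₁ d≡e                        = d≡e
      ... | inj₂ (inj₁ ≡.refl)              = contradiction hd≈ε hA²≉ε
      ... | inj₂ (inj₂ (j , c , [d,x]≡A²)) = contradiction hA²≈ε hA²≉ε
        where
        x : D
        x = j , c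
        hA²≈ε : h A² ≈ ε
        hA²≈ε = begin
          h A²                                    ≡⟨ ≡.cong h [d,x]≡A² ⟨
          h (d · (x · (d ⁻¹ᴰ · x ⁻¹ᴰ)))           ≈⟨ h-homo d _ ⟩
          h d ∙ h (x · (d ⁻¹ᴰ · x ⁻¹ᴰ))           ≈⟨ ∙-cong hd≈ε (h-homo x _) ⟩
          ε ∙ (h x ∙ h (d ⁻¹ᴰ · x ⁻¹ᴰ))           ≈⟨ identityˡ _ ⟩
          h x ∙ h (d ⁻¹ᴰ · x ⁻¹ᴰ)                 ≈⟨ ∙-congˡ (h-homo (d ⁻¹ᴰ) _) ⟩
          h x ∙ (h (d ⁻¹ᴰ) ∙ h (x ⁻¹ᴰ))           ≈⟨ ∙-congˡ (∙-cong (h-⁻¹ d) (h-⁻¹ x)) ⟩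
          h x ∙ (h d ⁻¹ ∙ h x ⁻¹)                 ≈⟨ ∙-congˡ (∙-congʳ (trans (⁻¹-cong hd≈ε) ε⁻¹≈ε)) ⟩
          h x ∙ (ε ∙ h x ⁻¹)                      ≈⟨ ∙-congˡ (identityˡ _) ⟩
          h x ∙ h x ⁻¹                            ≈⟨ inverseʳ _ ⟩
          ε                                       ∎

      h-injective : ∀ d d′ → h d ≈ h d′ → d ≡ d′
      h-injective d d′ hd≈hd′ = GroupProperties.x∙y⁻¹≈ε⇒x≈y D₈ d d′ (h-kernel _ (begin
        h (d · d′ ⁻¹ᴰ)   ≈⟨ h-homo d (d′ ⁻¹ᴰ) ⟩
        h d ∙ h (d′ ⁻¹ᴰ) ≈⟨ ∙-cong hd≈hd′ (h-⁻¹ d′) ⟩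
        h d′ ∙ h d′ ⁻¹   ≈⟨ inverseʳ _ ⟩
        ε                ∎))

      -- The map is the inverse of `h`: it returns the preimage that `Generated⇒image` extracts from
      -- a derivation.
      generatedSubgroup≅D₈ : generatedSubgroup 𝒢 (_∈ (s ∷ t ∷ [])) ≅ D₈
      generatedSubgroup≅D₈ = code , record
        { isGroupMonomorphism = record
          { isGroupHomomorphism = record
            { isMonoidHomomorphism = record
              { isMagmaHomomorphism = record
                { isRelHomomorphism = record { cong = λ {x} {y} → code-cong x y }
                -- `Generated⇒image` sends `mult`, `unit` and `inv` to the corresponding operations
                -- of `D`, so the homomorphism laws hold by computation.
                ; homo = λ _ _ → ≡.refl
                }
              ; ε-homo = ≡.refl
              }
            ; ⁻¹-homo = λ _ → ≡.refl
            }
          ; injective = λ {x} {y} code≡ →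
              trans (sym (h-code x)) (trans (reflexive (≡.cong h code≡)) (h-code y))
          }
        ; surjective = λ d → (h d , image⇒Generated d) , λ {x} x≈hd →
            h-injective (code x) d (trans (h-code x) x≈hd)
        }
        where
        code : ∃ ⟨s,t⟩ → D
        code (_ , p) = proj₁ (Generated⇒image p)
        h-code : ∀ x → h (code x) ≈ proj₁ x
        h-code (_ , p) = proj₂ (Generated⇒image p)
        -- `code` is defined by recursion on derivations; injectivity of `h` makes its value depend
        -- only on the element derived.
        code-cong : ∀ x y → proj₁ x ≈ proj₁ y → code x ≡ code y
        code-cong x y x≈y =
          h-injective (code x) (code y) (trans (h-code x) (trans x≈y (sym (h-code y))))

-- Cancellation and exchange for `_⊕_`.

⊕-cancelˡ : ∀ {n} (u : 𝔹^ n) {v w} → u ⊕ v ≡ u ⊕ w → v ≡ w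
⊕-cancelˡ u {v} {w} eq = begin
  v            ≡⟨ ⊕-involutiveʳ v u ⟨
  (v ⊕ u) ⊕ u  ≡⟨ ≡.cong (_⊕ u) (≡.trans (⊕-comm v u) (≡.trans eq (⊕-comm u w))) ⟩
  (w ⊕ u) ⊕ u  ≡⟨ ⊕-involutiveʳ w u ⟩
  w            ∎
  where
  open ≡.≡-Reasoning
  ⊕-comm = zipWith-comm xor-comm

⊕-exchange : ∀ {n} (u v w : 𝔹^ n) → (u ⊕ v) ⊕ w ≡ (u ⊕ w) ⊕ v
⊕-exchange u v w = begin
  (u ⊕ v) ⊕ w  ≡⟨ zipWith-assoc xor-assoc u v w ⟩
  u ⊕ (v ⊕ w)  ≡⟨ ≡.cong (u ⊕_) (zipWith-comm xor-comm v w) ⟩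
  u ⊕ (w ⊕ v)  ≡⟨ zipWith-assoc xor-assoc u w v ⟨
  (u ⊕ w) ⊕ v  ∎
  where open ≡.≡-Reasoning

-- The order of `φγ`, computed in coordinates.

module _ {n m k : ℕ} (f : 𝔹^ n → 𝔹^ m) (g : 𝔹^ m → 𝔹^ k) where

  open Group (G (n + m + k)) using (_∙_; _≈_; ε; monoid)
  open MonoidMult monoid renaming (_×_ to power)
  open ≡.≡-Reasoning

  φγ : Group.Carrier (G (n + m + k))
  φγ = φ k f ∙ γ n g

  φγ-fun : 𝔹^ (n + m + k) → 𝔹^ (n + m + k)
  φγ-fun = Inverse.to φγ

  φγ-fun-β : ∀ x y z → φγ-fun ((x ++ y) ++ z) ≡ (x ++ (y ⊕ f x)) ++ (z ⊕ g y)
  φγ-fun-β x y z = ≡.trans (≡.cong (φ-fun k f) (γ-fun-β n g x y z)) (φ-fun-β k f x y (z ⊕ g y))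

  -- The two additions of `f x` to `y` cancel, but `g` is evaluated once before and once after the
  -- first of them.
  φγ²-β : ∀ x y z →
          φγ-fun (φγ-fun ((x ++ y) ++ z)) ≡ (x ++ y) ++ ((z ⊕ g y) ⊕ g (y ⊕ f x))
  φγ²-β x y z = begin
    φγ-fun (φγ-fun ((x ++ y) ++ z))
      ≡⟨ ≡.cong φγ-fun (φγ-fun-β x y z) ⟩
    φγ-fun ((x ++ (y ⊕ f x)) ++ (z ⊕ g y))
      ≡⟨ φγ-fun-β x (y ⊕ f x) (z ⊕ g y) ⟩
    (x ++ ((y ⊕ f x) ⊕ f x)) ++ ((z ⊕ g y) ⊕ g (y ⊕ f x))
      ≡⟨ ≡.cong (λ w → (x ++ w) ++ ((z ⊕ g y) ⊕ g (y ⊕ f x))) (⊕-involutiveʳ y (f x)) ⟩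
    (x ++ y) ++ ((z ⊕ g y) ⊕ g (y ⊕ f x))
      ∎

  -- `φγ` squared translates `z` by a vector depending only on `x` and `y`, which it fixes; applying
  -- that translation twice cancels it.
  φγ⁴-β : ∀ x y z →
          φγ-fun (φγ-fun (φγ-fun (φγ-fun ((x ++ y) ++ z)))) ≡ (x ++ y) ++ z
  φγ⁴-β x y z = begin
    φγ-fun (φγ-fun (φγ-fun (φγ-fun ((x ++ y) ++ z))))
      ≡⟨ ≡.cong (λ v → φγ-fun (φγ-fun v)) (φγ²-β x y z) ⟩
    φγ-fun (φγ-fun ((x ++ y) ++ ((z ⊕ a) ⊕ b)))
      ≡⟨ φγ²-β x y ((z ⊕ a) ⊕ b) ⟩
    (x ++ y) ++ ((((z ⊕ a) ⊕ b) ⊕ a) ⊕ b)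
      ≡⟨ ≡.cong (λ w → (x ++ y) ++ (w ⊕ a ⊕ b)) (⊕-exchange z a b) ⟩
    (x ++ y) ++ ((((z ⊕ b) ⊕ a) ⊕ a) ⊕ b)
      ≡⟨ ≡.cong (λ w → (x ++ y) ++ (w ⊕ b)) (⊕-involutiveʳ (z ⊕ b) a) ⟩
    (x ++ y) ++ ((z ⊕ b) ⊕ b)
      ≡⟨ ≡.cong ((x ++ y) ++_) (⊕-involutiveʳ z b) ⟩
    (x ++ y) ++ z
      ∎
    where
    a = g y
    b = g (y ⊕ f x)

  φγ⁴≈ε : power 4 φγ ≈ ε
  φγ⁴≈ε v = ≡.trans (to-power-4 φγ v)
    -- `parts-η` carries the identity from concatenated vectors to an arbitrary `v`.
    (≡.subst (λ w → φγ-fun (φγ-fun (φγ-fun (φγ-fun w))) ≡ w) (parts-η n m k v)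
      (φγ⁴-β (xPart n m k v) (yPart n m k v) (zPart n m k v)))
    where
    -- Stated for a variable τ: unfolding the fourfold composite of φγ itself is expensive.
    to-power-4 : ∀ τ v → let open Inverse τ in
                 Inverse.to (power 4 τ) v ≡ to (to (to (to v)))
    to-power-4 _ _ = ≡.refl

  φγ²≉ε : NonDegenerate f g → ¬ power 2 φγ ≈ ε
  φγ²≉ε (x , y , g[y⊕fx]≢gy) φγ²≈ε = g[y⊕fx]≢gy (⊕-cancelˡ z (begin
    z ⊕ b              ≡⟨ ≡.cong (_⊕ b) z-fixed ⟨
    ((z ⊕ a) ⊕ b) ⊕ b  ≡⟨ ⊕-involutiveʳ (z ⊕ a) b ⟩
    z ⊕ a              ∎))
    where
    -- An arbitrary choice: `z` cancels from the equation obtained.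
    z = replicate k false
    a = g y
    b = g (y ⊕ f x)
    z-fixed : (z ⊕ a) ⊕ b ≡ z
    z-fixed = ++-injectiveʳ (x ++ y) (x ++ y)
      (≡.trans (≡.sym (φγ²-β x y z)) (φγ²≈ε ((x ++ y) ++ z)))

lemma11 : (n m k : ℕ) .{{_ : NonZero n}} .{{_ : NonZero m}} .{{_ : NonZero k}}
    (f : 𝔹^ n → 𝔹^ m) (g : 𝔹^ m → 𝔹^ k) →
    (∀ σ → Generated (G (n + m + k)) (generators f g) σ ⇔ σ ∈ᴳ G₂ₛ-elements f g) ×
    (NonDegenerate f g → G₂ₛ f g ≅ D₈)
lemma11 n m k f g =
  Generated⇔members elements≋G₂ₛ-elements ,
  λ nonDegenerate → generatedSubgroup≅D₈ (φγ²≉ε f g nonDegenerate)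
  where
  -- With `s` as `φ` and `t` as `γ`, `r` is `φγ`; the involution proofs fit because `_≈_` is
  -- pointwise equality.
  open DihedralImage (G (n + m + k)) (φ k f) (γ n g)
         (φ-fun-involutive k f) (γ-fun-involutive n g) (φγ⁴≈ε f g)
  -- The two lists agree definitionally, but comparing them as lists of inverse pairs would
  -- also compare all the inverse proofs, so only the underlying functions are compared.
  elements≋G₂ₛ-elements : Pointwise (Group._≈_ (G (n + m + k))) elements (G₂ₛ-elements f g)
  elements≋G₂ₛ-elements =
      (λ _ → ≡.refl) ∷ (λ _ → ≡.refl) ∷ (λ _ → ≡.refl) ∷ (λ _ → ≡.refl)
    ∷ (λ _ → ≡.refl) ∷ (λ _ → ≡.refl) ∷ (λ _ → ≡.refl) ∷ (λ _ → ≡.refl) ∷ []
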